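{- For every odd $m$ with $3\le m\leq 17$, and for every odd $m\ge3$ satisfying the cyclic interval property, namely that for every subset $x\subseteq\mathbb{Z}_m$ with $x\notin\{\emptyset,\mathbb{Z}_m\}$ there exists an arc $W\subseteq\mathbb{Z}_m$ with $|W\triangle x|<\min(|W|,\,m-|W|)$, one has $$k_{\min}(C_m)=m-1 .$$
   Context: $C_m$ is the cycle graph on $m$ vertices. An arc in $\mathbb{Z}_m$ is a cyclic interval, i.e. a set of consecutive residues; $\triangle$ is symmetric difference. For a generating set $S\subseteq\mathbb{Z}_2^k\setminus\{0\}$, $\mathrm{Cay}(\mathbb{Z}_2^k,S)$ is the graph on $\mathbb{Z}_2^k$ with edges $\{g,g+s\}$, $s\in S$. $k_{\min}(G)$ is the least $k$ such that the finite connected graph $G$ embeds isometrically (preserving shortest-path distances) into $\mathrm{Cay}(\mathbb{Z}_2^k,S)$ for some such $S$. -}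

module Defs where

open import Data.Fin.Base using (Fin; toℕ)
open import Data.Fin.Properties using (toℕ<n; toℕ-fromℕ<)
open import Data.Fin.Subset using (Subset; _∈_; _∪_; _─_; ∣_∣; ⊥; ⊤)
open import Data.Nat.Base as ℕ
  using (ℕ; suc; _≤_; _<_; _∸_; _⊓_; NonZero; s≤s)
open import Data.Nat.DivMod using (_mod_; _%_; m<n⇒m%n≡m; n%n≡0; m%n<n)
import Data.Nat.Properties as ℕ
open import Data.Parity.Base as ℙ using (Parity; 0ℙ)
import Data.Parity.Properties as ℙ
open import Data.Product.Base using (Σ-syntax; ∃-syntax; _×_; _,_)
open import Data.Sum.Base using (_⊎_; inj₁; inj₂; swap)
open import Data.Vec.Base using (Vec; []; _∷_; replicate; zipWith)
open import Data.Vec.Properties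
  using (zipWith-assoc; zipWith-identityˡ; zipWith-identityʳ)
open import Function.Bundles using (_⇔_)
open import Level using (0ℓ)
open import Relation.Binary.PropositionalEquality
open import Relation.Nullary using (¬_; contradiction)
open import Relation.Unary using (Pred)


record Graph : Set₁ where
  field
    Vertex      : Set
    Adj         : Vertex → Vertex → Set
    symmetric   : ∀ {u v} → Adj u v → Adj v u
    irreflexive : ∀ {v} → ¬ Adj v v

open Graph public using (Vertex)

data Walk (G : Graph) : Vertex G → Vertex G → ℕ → Set where
  nil  : ∀ {u} → Walk G u u 0
  cons : ∀ {u v w n} → Graph.Adj G u v → Walk G v w n → Walk G u w (suc n)

-- The relation "d(u , v) = d"; it holds for no d when u and v are not
-- connected.
Dist : (G : Graph) → Vertex G → Vertex G → ℕ → Set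
Dist G u v d = Walk G u v d × (∀ n → Walk G u v n → d ≤ n)

IsIsometric : (G H : Graph) → (Vertex G → Vertex H) → Set
IsIsometric G H f = ∀ u v d → Dist G u v d ⇔ Dist H (f u) (f v) d

-- Cayley graphs of ℤ₂ᵏ; Parity with its addition is the group ℤ₂.

ℤ₂^ : ℕ → Set
ℤ₂^ k = Vec Parity k

0# : ∀ {k} → ℤ₂^ k
0# = replicate _ 0ℙ

infixl 6 _+_

_+_ : ∀ {k} → ℤ₂^ k → ℤ₂^ k → ℤ₂^ k
_+_ = zipWith ℙ._+_

-- The subgroup generated by S. Closure under inverses is automatic, since
-- every element of ℤ₂ᵏ is its own inverse.
data ⟨_⟩ {k} (S : Pred (ℤ₂^ k) 0ℓ) : Pred (ℤ₂^ k) 0ℓ where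
  gen  : ∀ {s} → S s → ⟨ S ⟩ s
  zero : ⟨ S ⟩ 0#
  add  : ∀ {g h} → ⟨ S ⟩ g → ⟨ S ⟩ h → ⟨ S ⟩ (g + h)

Generates : ∀ {k} → Pred (ℤ₂^ k) 0ℓ → Set
Generates S = ∀ g → ⟨ S ⟩ g

private
  +-same : ∀ {k} (g : ℤ₂^ k) → g + g ≡ 0#
  +-same [] = refl
  +-same (p ∷ g) = cong₂ _∷_ (ℙ.p+p≡0ℙ p) (+-same g)

  +-assoc : ∀ {k} (f g h : ℤ₂^ k) → (f + g) + h ≡ f + (g + h)
  +-assoc = zipWith-assoc ℙ.+-assoc

  +-identityˡ : ∀ {k} (g : ℤ₂^ k) → 0# + g ≡ g
  +-identityˡ = zipWith-identityˡ ℙ.+-identityˡ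

  +-identityʳ : ∀ {k} (g : ℤ₂^ k) → g + 0# ≡ g
  +-identityʳ = zipWith-identityʳ ℙ.+-identityʳ

  g+s+s≡g : ∀ {k} (g s : ℤ₂^ k) → (g + s) + s ≡ g
  g+s+s≡g g s =
    trans (+-assoc g s s) (trans (cong (g +_) (+-same s)) (+-identityʳ g))

  g≡g+s⇒s≡0 : ∀ {k} (g s : ℤ₂^ k) → g ≡ g + s → s ≡ 0#
  g≡g+s⇒s≡0 g s eq = begin
    s            ≡⟨ +-identityˡ s ⟨
    0# + s       ≡⟨ cong (_+ s) (+-same g) ⟨
    (g + g) + s  ≡⟨ +-assoc g g s ⟩
    g + (g + s)  ≡⟨ cong (g +_) eq ⟨
    g + g        ≡⟨ +-same g ⟩
    0#           ∎
    where open ≡-Reasoning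

Cay : ∀ k (S : Pred (ℤ₂^ k) 0ℓ) → ¬ S 0# → Graph
Cay k S 0∉S = record
  { Vertex      = ℤ₂^ k
  ; Adj         = λ g h → ∃[ s ] S s × h ≡ g + s
  ; symmetric   = λ { {g} (s , s∈S , refl) → s , s∈S , sym (g+s+s≡g g s) }
  ; irreflexive = λ { {g} (s , s∈S , eq) → 0∉S (subst S (g≡g+s⇒s≡0 g s eq) s∈S) }
  }

EmbedsInDimension : Graph → ℕ → Set₁
EmbedsInDimension G k =
  Σ[ S ∈ Pred (ℤ₂^ k) 0ℓ ] Σ[ 0∉S ∈ ¬ S 0# ]
    Generates S × ∃[ f ] IsIsometric G (Cay k S 0∉S) f

-- k_min(G) = k, as a relation: it determines k when it holds, but the least
-- dimension cannot be extracted from an arbitrary graph (it need not exist).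
IsKMin : Graph → ℕ → Set₁
IsKMin G k = EmbedsInDimension G k × (∀ j → EmbedsInDimension G j → k ≤ j)

-- Residues modulo m, cycles and arcs; ℤ/m is represented by Fin m.

shift : ∀ {m} .{{_ : NonZero m}} → Fin m → ℕ → Fin m
shift {m} a j = (toℕ a ℕ.+ j) mod m

3≤⇒nonZero : ∀ {m} → 3 ≤ m → NonZero m
3≤⇒nonZero (s≤s _) = _

private
  shift-1-≢ : ∀ {m} .{{_ : NonZero m}} → 3 ≤ m → (i : Fin m) → i ≢ shift i 1
  shift-1-≢ {m} 3≤m i eq with ℕ.m≤n⇒m<n∨m≡n (toℕ<n i)
  ... | inj₁ 1+i<m = ℕ.1+n≢n (sym (begin
    toℕ i                   ≡⟨ cong toℕ eq ⟩
    toℕ (shift i 1)         ≡⟨ toℕ-fromℕ< (m%n<n (toℕ i ℕ.+ 1) m) ⟩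
    (toℕ i ℕ.+ 1) % m       ≡⟨ cong (_% m) (ℕ.+-comm (toℕ i) 1) ⟩
    suc (toℕ i) % m         ≡⟨ m<n⇒m%n≡m 1+i<m ⟩
    suc (toℕ i)             ∎))
    where open ≡-Reasoning
  ... | inj₂ 1+i≡m = contradiction (subst (3 ≤_) m≡1 3≤m) λ { (s≤s ()) }
    where
    open ≡-Reasoning
    i≡0 : toℕ i ≡ 0
    i≡0 = begin
      toℕ i                   ≡⟨ cong toℕ eq ⟩
      toℕ (shift i 1)         ≡⟨ toℕ-fromℕ< (m%n<n (toℕ i ℕ.+ 1) m) ⟩
      (toℕ i ℕ.+ 1) % m       ≡⟨ cong (_% m) (ℕ.+-comm (toℕ i) 1) ⟩
      suc (toℕ i) % m         ≡⟨ cong (_% m) 1+i≡m ⟩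
      m % m                   ≡⟨ n%n≡0 m ⟩
      0                       ∎
    m≡1 : m ≡ 1
    m≡1 = trans (sym 1+i≡m) (cong suc i≡0)

cycle : ∀ m → 3 ≤ m → Graph
cycle m 3≤m = record
  { Vertex      = Fin m
  ; Adj         = λ i j → j ≡ shift i 1 ⊎ i ≡ shift j 1
  ; symmetric   = swap
  ; irreflexive = λ { {i} (inj₁ eq) → shift-1-≢ 3≤m i eq
                    ; {i} (inj₂ eq) → shift-1-≢ 3≤m i eq }
  }
  where instance _ = 3≤⇒nonZero 3≤m

-- W = {a, a+1, …, a+ℓ-1} modulo m. The empty and the full set are allowed.
IsArc : ∀ {m} .{{_ : NonZero m}} → Subset m → Set
IsArc {m} W =
  Σ[ a ∈ Fin m ] ∃[ ℓ ] ∀ i → i ∈ W ⇔ (∃[ j ] j < ℓ × i ≡ shift a j)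

infixl 6 _△_

_△_ : ∀ {m} → Subset m → Subset m → Subset m
p △ q = (p ─ q) ∪ (q ─ p)

CyclicIntervalProperty : ∀ m .{{_ : NonZero m}} → Set
CyclicIntervalProperty m =
  ∀ (x : Subset m) → x ≢ ⊥ → x ≢ ⊤ →
  Σ[ W ∈ Subset m ] IsArc W × ∣ W △ x ∣ < ∣ W ∣ ⊓ (m ∸ ∣ W ∣)

{-# OPTIONS --safe #-}
module Submission where

-- Upper bound: the vectors 1ⁱ0ᵏ⁻ⁱ with k = m − 1 trace an isometric m-cycle in the folded cube,
-- generated by the unit vectors and the all-ones vector.
--
-- Lower bound, for m = 2n + 1: let sᵢ be the generator used by the i-th edge of an embedded cycle.
-- In dimension below m − 1, some x ⊆ ℤₘ other than ∅ and ℤₘ satisfies Σ_{i ∈ x} sᵢ = 0, and so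
-- does its complement. For an arc W of n positions, Σ_{W △ x} = Σ_W, so isometry forces
-- n ≤ |W △ x|, that is |W ∩ x| ≤ |x ∖ W|. The same for the complement of x gives
-- |x ∖ W| ≤ |W ∩ x| + 1. As |x| is fixed, |W ∩ x| is the same for all W; sliding W by one position
-- shows that x is invariant under translation by n, hence by 2n = −1, so it is ∅ or ℤₘ.

open import Defs
open import Data.Nat.Base using (ℕ; _≤_; _∸_; _%_)
open import Data.Sum.Base using (_⊎_)
open import Relation.Binary.PropositionalEquality using (_≡_)

open import Algebra.Bundles using (AbelianGroup; CommutativeMonoid)
import Algebra.Properties.CommutativeSemigroup as CommutativeSemigroupProperties
import Algebra.Properties.Group as GroupProperties
open import Data.Fin.Base as Fin using (Fin; toℕ; combine; remQuot)
open import Data.Fin.Properties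
  using (toℕ<n; toℕ-fromℕ<; toℕ-injective; combine-injective; combine-remQuot; pigeonhole; <⇒≢)
open import Data.Nat.Base as ℕ using (zero; suc; _<_; ∣_-_∣; z≤n; s≤s; z<s)
open import Data.Nat.DivMod
  using (_mod_; _/_; m≡m%n+[m/n]*n; m%n<n; m<n⇒m%n≡m; %-distribˡ-+; m%n%n≡m%n; n%n≡0;
         [m+n]%n≡m%n)
open import Data.Nat.Properties as ℕ using (module ≤-Reasoning)
open import Data.Parity.Base as ℙ using (Parity; 0ℙ; 1ℙ)
import Data.Parity.Properties as ℙ
open import Data.Product.Base using (∃-syntax; _×_; _,_; proj₁; proj₂)
open import Data.Sum.Base using (inj₁; inj₂)
open import Data.Vec.Base using ([]; _∷_; replicate; lookup)
open import Data.Vec.Properties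
  using (zipWith-assoc; zipWith-comm; zipWith-identityˡ; zipWith-identityʳ;
         lookup-zipWith; ∷-injectiveʳ; lookup-replicate)
open import Data.Vec.Relation.Binary.Pointwise.Extensional using (ext; Pointwise-≡⇒≡)
open import Function.Base using (_∘_; id)
open import Function.Bundles using (mk⇔; Equivalence)
open import Level using (0ℓ)
open import Relation.Binary.PropositionalEquality
  using (_≢_; refl; sym; trans; cong; cong₂; subst; subst₂; isEquivalence; module ≡-Reasoning)
open import Relation.Nullary using (¬_; yes; no; contradiction)
open import Relation.Unary using (Pred)

-- The group ℤ₂ᵏ

+-same : ∀ {k} (g : ℤ₂^ k) → g + g ≡ 0#
+-same []      = refl
+-same (p ∷ g) = cong₂ _∷_ (ℙ.p+p≡0ℙ p) (+-same g)

ℤ₂^-abelianGroup : ℕ → AbelianGroup 0ℓ 0ℓ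
ℤ₂^-abelianGroup k = record
  { Carrier = ℤ₂^ k
  ; _≈_     = _≡_
  ; _∙_     = _+_
  ; ε       = 0#
  ; _⁻¹     = id
  ; isAbelianGroup = record
    { isGroup = record
      { isMonoid = record
        { isSemigroup = record
          { isMagma = record { isEquivalence = isEquivalence ; ∙-cong = cong₂ _+_ }
          ; assoc   = zipWith-assoc ℙ.+-assoc
          }
        ; identity = zipWith-identityˡ ℙ.+-identityˡ , zipWith-identityʳ ℙ.+-identityʳ
        }
      ; inverse = +-same , +-same
      ; ⁻¹-cong = id
      }
    ; comm = zipWith-comm ℙ.+-comm
    }
  }

module ℤ₂^ {k : ℕ} where
  open AbelianGroup (ℤ₂^-abelianGroup k) public
    using (assoc; comm; identityˡ; identityʳ)
  open GroupProperties (AbelianGroup.group (ℤ₂^-abelianGroup k)) public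
    using (inverseˡ-unique) renaming (\\-leftDividesʳ to g+[g+h]≡h)
  open CommutativeSemigroupProperties
    (AbelianGroup.commutativeSemigroup (ℤ₂^-abelianGroup k)) public
    using (interchange)

∣_∣ₚ : Parity → ℕ
∣ 0ℙ ∣ₚ = 0
∣ 1ℙ ∣ₚ = 1

weight : ∀ {k} → ℤ₂^ k → ℕ
weight []      = 0
weight (p ∷ g) = ∣ p ∣ₚ ℕ.+ weight g

1# : ∀ {k} → ℤ₂^ k
1# = replicate _ 1ℙ

weight-0# : ∀ k → weight (0# {k}) ≡ 0
weight-0# zero    = refl
weight-0# (suc k) = weight-0# k

weight-+ : ∀ {k} (g h : ℤ₂^ k) → weight (g + h) ≤ weight g ℕ.+ weight h
weight-+ []       []       = z≤n
weight-+ (0ℙ ∷ g) (0ℙ ∷ h) = weight-+ g h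
weight-+ (0ℙ ∷ g) (1ℙ ∷ h) =
  subst (suc (weight (g + h)) ≤_) (sym (ℕ.+-suc (weight g) (weight h))) (s≤s (weight-+ g h))
weight-+ (1ℙ ∷ g) (0ℙ ∷ h) = s≤s (weight-+ g h)
weight-+ (1ℙ ∷ g) (1ℙ ∷ h) =
  ℕ.≤-trans (weight-+ g h) (ℕ.+-mono-≤ (ℕ.n≤1+n _) (ℕ.n≤1+n _))

weight-1#+ : ∀ {k} (g : ℤ₂^ k) → weight (1# + g) ℕ.+ weight g ≡ k
weight-1#+ []       = refl
weight-1#+ (0ℙ ∷ g) = cong suc (weight-1#+ g)
weight-1#+ (1ℙ ∷ g) = trans (ℕ.+-suc _ _) (cong suc (weight-1#+ g))

-- Walks

Walk-++ : ∀ {G u v w p q} → Walk G u v p → Walk G v w q → Walk G u w (p ℕ.+ q)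
Walk-++ nil        ρ = ρ
Walk-++ (cons e π) ρ = cons e (Walk-++ π ρ)

Walk-snoc : ∀ {G u v w n} → Walk G u v n → Graph.Adj G v w → Walk G u w (suc n)
Walk-snoc nil        e = cons e nil
Walk-snoc (cons d π) e = cons d (Walk-snoc π e)

Walk-reverse : ∀ {G u v n} → Walk G u v n → Walk G v u n
Walk-reverse         nil        = nil
Walk-reverse {G = G} (cons e π) = Walk-snoc (Walk-reverse π) (Graph.symmetric G e)

Walk-map : ∀ {G H} (f : Vertex G → Vertex H) →
           (∀ {u v} → Graph.Adj G u v → Graph.Adj H (f u) (f v)) →
           ∀ {u v n} → Walk G u v n → Walk H (f u) (f v) n
Walk-map f hom nil        = nil
Walk-map f hom (cons e π) = cons (hom e) (Walk-map f hom π)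

Walk₁⇒Adj : ∀ {G u v} → Walk G u v 1 → Graph.Adj G u v
Walk₁⇒Adj (cons e nil) = e

Adj⇒Dist₁ : ∀ {G u v} → Graph.Adj G u v → Dist G u v 1
Adj⇒Dist₁ {G} {u} {v} e = cons e nil , bound
  where
  bound : ∀ n → Walk G u v n → 1 ≤ n
  bound zero    nil = contradiction e (Graph.irreflexive G)
  bound (suc n) _   = z<s

-- Adjacency enters as distance exactly 1, the only form in which `IsIsometric` sees edges; the
-- absence of loops rules out distance 0.
isometric⇒Adj : ∀ {G H f} → IsIsometric G H f →
                ∀ {u v} → Graph.Adj G u v → Graph.Adj H (f u) (f v)
isometric⇒Adj {G} {H} iso {u} {v} e =
  Walk₁⇒Adj {H} (proj₁ (Equivalence.to (iso u v 1) (Adj⇒Dist₁ {G} e)))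

-- The homomorphism shows that distances do not grow, and lifting walks without lengthening them
-- shows that they do not shrink. Working with walks avoids computing a distance in either graph.
liftsWalks⇒isometric :
  ∀ {G H} (f : Vertex G → Vertex H) →
  (∀ {u v} → Graph.Adj G u v → Graph.Adj H (f u) (f v)) →
  (∀ {u v n} → Walk H (f u) (f v) n → ∃[ l ] l ≤ n × Walk G u v l) →
  IsIsometric G H f
liftsWalks⇒isometric {G} {H} f hom lift u v d = mk⇔ to from
  where
  to : Dist G u v d → Dist H (f u) (f v) d
  to (π , d≤) = Walk-map f hom π , λ n ρ →
    let l , l≤n , σ = lift ρ in ℕ.≤-trans (d≤ l σ) l≤n
  from : Dist H (f u) (f v) d → Dist G u v d
  from (π , d≤) =
    let l , l≤d , σ = lift π
        l≡d = ℕ.≤-antisym l≤d (d≤ l (Walk-map f hom σ))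
    in subst (Walk G u v) l≡d σ , λ n ρ → d≤ n (Walk-map f hom ρ)

-- The folded cube

⟨⟩-mono : ∀ {k} {S T : Pred (ℤ₂^ k) 0ℓ} → (∀ {g} → S g → T g) → ∀ {g} → ⟨ S ⟩ g → ⟨ T ⟩ g
⟨⟩-mono S⊆T (gen s)   = gen (S⊆T s)
⟨⟩-mono S⊆T zero      = zero
⟨⟩-mono S⊆T (add g h) = add (⟨⟩-mono S⊆T g) (⟨⟩-mono S⊆T h)

-- Prepending `0ℙ` is additive and keeps the weight, so it sends unit vectors to unit vectors.
0∷-⟨weight≡1⟩ : ∀ {k} {g : ℤ₂^ k} →
                ⟨ (λ h → weight h ≡ 1) ⟩ g → ⟨ (λ h → weight h ≡ 1) ⟩ (0ℙ ∷ g)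
0∷-⟨weight≡1⟩ (gen s)   = gen s
0∷-⟨weight≡1⟩ zero      = zero
0∷-⟨weight≡1⟩ (add g h) = add (0∷-⟨weight≡1⟩ g) (0∷-⟨weight≡1⟩ h)

weight≡1-generates : ∀ k → Generates {k} (λ g → weight g ≡ 1)
weight≡1-generates zero    []       = zero
weight≡1-generates (suc k) (0ℙ ∷ g) = 0∷-⟨weight≡1⟩ (weight≡1-generates k g)
weight≡1-generates (suc k) (1ℙ ∷ g) =
  subst (λ h → ⟨ _ ⟩ (1ℙ ∷ h)) (ℤ₂^.identityˡ g)
    (add (gen (cong suc (weight-0# k))) (0∷-⟨weight≡1⟩ (weight≡1-generates k g)))

FoldedCubeGen : ∀ k → Pred (ℤ₂^ k) 0ℓ
FoldedCubeGen k g = weight g ≡ 1 ⊎ g ≡ 1#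

0#∉FoldedCubeGen : ∀ k → ¬ FoldedCubeGen (suc k) 0#
0#∉FoldedCubeGen k (inj₁ eq) with () ← trans (sym eq) (weight-0# k)

-- The dimension is `suc k` because in dimension 0 the all-ones vector is 0, which may not be a
-- generator.
foldedCube : ℕ → Graph
foldedCube k = Cay (suc k) (FoldedCubeGen (suc k)) (0#∉FoldedCubeGen k)

-- The alternatives follow the parity of the number of all-ones steps. If it is even, these steps
-- cancel and `g + h` is a sum of at most n unit vectors. If it is odd, the complement of `g + h` is
-- a sum of at most n - 1 of them. In the induction a unit vector changes the weight by at most one
-- and keeps the alternative, while `1#` complements and swaps the two.
foldedCube-walk-bound :
  ∀ k {g h n} → Walk (foldedCube k) g h n →
  weight (g + h) ≤ n ⊎ suc (suc k) ≤ weight (g + h) ℕ.+ n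
foldedCube-walk-bound k {g} nil =
  inj₁ (ℕ.≤-reflexive (trans (cong weight (+-same g)) (weight-0# k)))
foldedCube-walk-bound k {g} {h} {suc n} (cons (s , s∈S , refl) π) =
  lemma s∈S (subst (λ d → weight d ≤ n ⊎ m ≤ weight d ℕ.+ n) [g+s]+h≡s+d (foldedCube-walk-bound k π))
  where
  open ≤-Reasoning
  m = suc (suc k)
  d = g + h
  [g+s]+h≡s+d : (g + s) + h ≡ s + d
  [g+s]+h≡s+d = trans (cong (_+ h) (ℤ₂^.comm g s)) (ℤ₂^.assoc s g h)
  lemma : FoldedCubeGen (suc k) s → weight (s + d) ≤ n ⊎ m ≤ weight (s + d) ℕ.+ n →
          weight d ≤ suc n ⊎ m ≤ weight d ℕ.+ suc n
  lemma (inj₁ s₁) (inj₁ s+d≤n) = inj₁ (begin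
    weight d                            ≡⟨ cong weight (ℤ₂^.g+[g+h]≡h s d) ⟨
    weight (s + (s + d))                ≤⟨ weight-+ s (s + d) ⟩
    weight s ℕ.+ weight (s + d)         ≡⟨ cong (ℕ._+ weight (s + d)) s₁ ⟩
    suc (weight (s + d))                ≤⟨ s≤s s+d≤n ⟩
    suc n                               ∎)
  lemma (inj₁ s₁) (inj₂ m≤s+d+n) = inj₂ (begin
    m                                   ≤⟨ m≤s+d+n ⟩
    weight (s + d) ℕ.+ n                ≤⟨ ℕ.+-monoˡ-≤ n (weight-+ s d) ⟩
    weight s ℕ.+ weight d ℕ.+ n         ≡⟨ cong (λ w → w ℕ.+ weight d ℕ.+ n) s₁ ⟩
    suc (weight d ℕ.+ n)                ≡⟨ ℕ.+-suc (weight d) n ⟨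
    weight d ℕ.+ suc n                  ∎)
  lemma (inj₂ refl) (inj₁ s+d≤n) = inj₂ (begin
    m                                   ≡⟨ cong suc (weight-1#+ d) ⟨
    suc (weight (1# + d) ℕ.+ weight d)  ≤⟨ s≤s (ℕ.+-monoˡ-≤ (weight d) s+d≤n) ⟩
    suc n ℕ.+ weight d                  ≡⟨ ℕ.+-comm (suc n) (weight d) ⟩
    weight d ℕ.+ suc n                  ∎)
  lemma (inj₂ refl) (inj₂ m≤s+d+n) = inj₁ (ℕ.m≤n⇒m≤1+n (ℕ.<⇒≤
    (ℕ.+-cancelˡ-< (weight (1# + d)) (weight d) n (begin-strict
      weight (1# + d) ℕ.+ weight d      ≡⟨ weight-1#+ d ⟩
      suc k                             <⟨ m≤s+d+n ⟩
      weight (1# + d) ℕ.+ n             ∎))))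

-- Prefix vectors and their Hamming distances

prefix : ∀ k → ℕ → ℤ₂^ k
prefix zero    _       = []
prefix (suc k) zero    = 0ℙ ∷ prefix k zero
prefix (suc k) (suc i) = 1ℙ ∷ prefix k i

prefix-0 : ∀ k → prefix k 0 ≡ 0#
prefix-0 zero    = refl
prefix-0 (suc k) = cong (0ℙ ∷_) (prefix-0 k)

prefix-full : ∀ k → prefix k k ≡ 1#
prefix-full zero    = refl
prefix-full (suc k) = cong (1ℙ ∷_) (prefix-full k)

-- Two prefixes differ exactly in the coordinates between their end points.
weight-prefix+prefix : ∀ {k i j} → i ≤ k → j ≤ k →
                       weight (prefix k i + prefix k j) ≡ ∣ i - j ∣
weight-prefix+prefix {zero}  z≤n       z≤n       = refl
weight-prefix+prefix {suc k} z≤n       z≤n       = weight-prefix+prefix {k} z≤n z≤n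
weight-prefix+prefix {suc k} z≤n       (s≤s j≤k) = cong suc (weight-prefix+prefix z≤n j≤k)
weight-prefix+prefix {suc k} (s≤s i≤k) z≤n       =
  cong suc (trans (weight-prefix+prefix i≤k z≤n) (ℕ.∣-∣-identityʳ _))
weight-prefix+prefix {suc k} (s≤s i≤k) (s≤s j≤k) = weight-prefix+prefix i≤k j≤k

-- Cycles

toℕ-mod : ∀ i k → toℕ (i mod suc k) ≡ i % suc k
toℕ-mod i k = toℕ-fromℕ< (m%n<n i (suc k))

mod-cong : ∀ i j k → i % suc k ≡ j % suc k → i mod suc k ≡ j mod suc k
mod-cong i j k eq = toℕ-injective (trans (toℕ-mod i k) (trans eq (sym (toℕ-mod j k))))

mod-toℕ : ∀ {k} (u : Fin (suc k)) → toℕ u mod suc k ≡ u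
mod-toℕ {k} u = toℕ-injective (trans (toℕ-mod (toℕ u) k) (m<n⇒m%n≡m (toℕ<n u)))

mod-periodic : ∀ k i → (i ℕ.+ suc k) mod suc k ≡ i mod suc k
mod-periodic k i = mod-cong (i ℕ.+ suc k) i k ([m+n]%n≡m%n i (suc k))

%-+ˡ : ∀ a j k → (a % suc k ℕ.+ j) % suc k ≡ (a ℕ.+ j) % suc k
%-+ˡ a j k = begin
  (a % m ℕ.+ j) % m              ≡⟨ %-distribˡ-+ (a % m) j m ⟩
  (a % m % m ℕ.+ j % m) % m      ≡⟨ cong (λ b → (b ℕ.+ j % m) % m) (m%n%n≡m%n a m) ⟩
  (a % m ℕ.+ j % m) % m          ≡⟨ %-distribˡ-+ a j m ⟨
  (a ℕ.+ j) % m                  ∎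
  where
  open ≡-Reasoning
  m = suc k

module Cycle (k : ℕ) (3≤m : 3 ≤ suc k) where

  m : ℕ
  m = suc k

  C : Graph
  C = cycle m 3≤m

  cycle-step : ∀ i → Graph.Adj C (i mod m) (suc i mod m)
  cycle-step i = inj₁ (mod-cong (suc i) (toℕ (i mod m) ℕ.+ 1) k (sym (begin
    (toℕ (i mod m) ℕ.+ 1) % m   ≡⟨ cong (λ a → (a ℕ.+ 1) % m) (toℕ-mod i k) ⟩
    (i % m ℕ.+ 1) % m           ≡⟨ %-+ˡ i 1 k ⟩
    (i ℕ.+ 1) % m               ≡⟨ cong (_% m) (ℕ.+-comm i 1) ⟩
    suc i % m                   ∎)))
    where open ≡-Reasoning

  arc-walk : ∀ a l → Walk C (a mod m) ((a ℕ.+ l) mod m) l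
  arc-walk a zero    = subst (λ b → Walk C (a mod m) (b mod m) 0) (sym (ℕ.+-identityʳ a)) nil
  arc-walk a (suc l) = cons (cycle-step a)
    (subst (λ b → Walk C (suc a mod m) (b mod m) l) (sym (ℕ.+-suc a l)) (arc-walk (suc a) l))

  private
    both-walks′ : ∀ {u v} → toℕ u ≤ toℕ v →
                  Walk C u v (toℕ v ∸ toℕ u) × Walk C u v (m ∸ (toℕ v ∸ toℕ u))
    both-walks′ {u} {v} u≤v =
      subst₂ (λ a b → Walk C a b d) (mod-toℕ u)
        (trans (cong (_mod m) (ℕ.m+[n∸m]≡n u≤v)) (mod-toℕ v))
        (arc-walk (toℕ u) d) ,
      -- The complementary arc is walked forwards from v past 0 to u + m, and then reversed.
      Walk-reverse (subst₂ (λ a b → Walk C a b (m ∸ d)) (mod-toℕ v)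
        (trans (cong (_mod m) v+[m∸d]≡u+m) (trans (mod-periodic k (toℕ u)) (mod-toℕ u)))
        (arc-walk (toℕ v) (m ∸ d)))
      where
      open ≡-Reasoning
      d = toℕ v ∸ toℕ u
      d≤m : d ≤ m
      d≤m = ℕ.≤-trans (ℕ.m∸n≤m (toℕ v) (toℕ u)) (ℕ.<⇒≤ (toℕ<n v))
      v+[m∸d]≡u+m : toℕ v ℕ.+ (m ∸ d) ≡ toℕ u ℕ.+ m
      v+[m∸d]≡u+m = begin
        toℕ v ℕ.+ (m ∸ d)               ≡⟨ cong (ℕ._+ (m ∸ d)) (ℕ.m+[n∸m]≡n u≤v) ⟨
        toℕ u ℕ.+ d ℕ.+ (m ∸ d)         ≡⟨ ℕ.+-assoc (toℕ u) d (m ∸ d) ⟩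
        toℕ u ℕ.+ (d ℕ.+ (m ∸ d))       ≡⟨ cong (toℕ u ℕ.+_) (ℕ.m+[n∸m]≡n d≤m) ⟩
        toℕ u ℕ.+ m                     ∎

  both-walks : ∀ u v → Walk C u v ∣ toℕ u - toℕ v ∣ × Walk C u v (m ∸ ∣ toℕ u - toℕ v ∣)
  both-walks u v with ℕ.≤-total (toℕ u) (toℕ v)
  ... | inj₁ u≤v =
    subst (λ d → Walk C u v d × Walk C u v (m ∸ d)) (sym (ℕ.m≤n⇒∣m-n∣≡n∸m u≤v)) (both-walks′ u≤v)
  ... | inj₂ v≤u =
    subst (λ d → Walk C u v d × Walk C u v (m ∸ d)) (sym (ℕ.m≤n⇒∣n-m∣≡n∸m v≤u))
      (let π , ρ = both-walks′ v≤u in Walk-reverse π , Walk-reverse ρ)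

  -- A step that does not wrap around flips one coordinate. The wrapping step leads from the
  -- all-ones vector back to 0, which is what the generator `1#` is for.
  prefix-adj : ∀ i → FoldedCubeGen k (prefix k (toℕ i) + prefix k (toℕ (shift i 1)))
  prefix-adj i with ℕ.m≤n⇒m<n∨m≡n (toℕ<n i)
  ... | inj₁ 1+i<m = inj₁ (begin
    weight (prefix k (toℕ i) + prefix k (toℕ (shift i 1)))
      ≡⟨ cong (λ j → weight (prefix k (toℕ i) + prefix k j)) shift≡ ⟩
    weight (prefix k (toℕ i) + prefix k (toℕ i ℕ.+ 1))
      ≡⟨ weight-prefix+prefix (ℕ.≤-trans (ℕ.m≤m+n _ 1) i+1≤k) i+1≤k ⟩
    ∣ toℕ i - toℕ i ℕ.+ 1 ∣                                  ≡⟨ ℕ.∣m-m+n∣≡n (toℕ i) 1 ⟩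
    1                                                        ∎)
    where
    open ≡-Reasoning
    i+1≤k : toℕ i ℕ.+ 1 ≤ k
    i+1≤k = subst (_≤ k) (ℕ.+-comm 1 (toℕ i)) (ℕ.≤-pred 1+i<m)
    shift≡ : toℕ (shift i 1) ≡ toℕ i ℕ.+ 1
    shift≡ = trans (toℕ-mod (toℕ i ℕ.+ 1) k) (m<n⇒m%n≡m (s≤s i+1≤k))
  ... | inj₂ 1+i≡m = inj₂ (begin
    prefix k (toℕ i) + prefix k (toℕ (shift i 1))
      ≡⟨ cong₂ (λ a b → prefix k a + prefix k b) (ℕ.suc-injective 1+i≡m) shift≡0 ⟩
    prefix k k + prefix k 0                         ≡⟨ cong₂ _+_ (prefix-full k) (prefix-0 k) ⟩
    1# + 0#                                         ≡⟨ ℤ₂^.identityʳ 1# ⟩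
    1#                                              ∎)
    where
    open ≡-Reasoning
    shift≡0 : toℕ (shift i 1) ≡ 0
    shift≡0 = begin
      toℕ (shift i 1)      ≡⟨ toℕ-mod (toℕ i ℕ.+ 1) k ⟩
      (toℕ i ℕ.+ 1) % m    ≡⟨ cong (_% m) (trans (ℕ.+-comm (toℕ i) 1) 1+i≡m) ⟩
      m % m                ≡⟨ n%n≡0 m ⟩
      0                    ∎

-- Upper bound: the cycle inside the folded cube

module Upper (k : ℕ) (3≤m : 3 ≤ suc (suc k)) where

  open Cycle (suc k) 3≤m

  toFoldedCube : Fin m → ℤ₂^ (suc k)
  toFoldedCube i = prefix (suc k) (toℕ i)

  toFoldedCube-adj : ∀ {u v} → Graph.Adj C u v →
                     Graph.Adj (foldedCube k) (toFoldedCube u) (toFoldedCube v)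
  toFoldedCube-adj {u} (inj₁ refl) = _ , prefix-adj u , sym (ℤ₂^.g+[g+h]≡h _ _)
  toFoldedCube-adj {_} {v} (inj₂ refl) = Graph.symmetric (foldedCube k)
    (_ , prefix-adj v , sym (ℤ₂^.g+[g+h]≡h _ _))

  toFoldedCube-walk-bound :
    ∀ {u v n} → Walk (foldedCube k) (toFoldedCube u) (toFoldedCube v) n →
    ∣ toℕ u - toℕ v ∣ ≤ n ⊎ m ≤ ∣ toℕ u - toℕ v ∣ ℕ.+ n
  toFoldedCube-walk-bound {u} {v} {n} π =
    subst (λ d → d ≤ n ⊎ m ≤ d ℕ.+ n)
      (weight-prefix+prefix (ℕ.≤-pred (toℕ<n u)) (ℕ.≤-pred (toℕ<n v)))
      (foldedCube-walk-bound k π)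

  -- Mapping a walk into the folded cube transfers the bound proved there, so walks in the cycle
  -- need no analysis of their own. The lower bound uses this again to see that a half turn is a
  -- geodesic.
  cycle-walk-bound : ∀ {u v n} → Walk C u v n →
                     ∣ toℕ u - toℕ v ∣ ≤ n ⊎ m ≤ ∣ toℕ u - toℕ v ∣ ℕ.+ n
  cycle-walk-bound π = toFoldedCube-walk-bound (Walk-map toFoldedCube toFoldedCube-adj π)

  embeds : EmbedsInDimension C (suc k)
  embeds =
    FoldedCubeGen (suc k) , 0#∉FoldedCubeGen k ,
    (λ g → ⟨⟩-mono inj₁ (weight≡1-generates (suc k) g)) ,
    toFoldedCube , liftsWalks⇒isometric toFoldedCube toFoldedCube-adj lift
    where
    lift : ∀ {u v n} → Walk (foldedCube k) (toFoldedCube u) (toFoldedCube v) n →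
           ∃[ l ] l ≤ n × Walk C u v l
    -- The two alternatives of the bound are answered by the two arcs between u and v, of lengths d
    -- and m - d.
    lift {u} {v} π with toFoldedCube-walk-bound π | both-walks u v
    ... | inj₁ d≤n   | ρ , _ = _ , d≤n , ρ
    ... | inj₂ m≤d+n | _ , ρ = _ , ℕ.m≤n+o⇒m∸n≤o m ∣ toℕ u - toℕ v ∣ m≤d+n , ρ

-- Sums over windows

-- Arcs of the cycle become intervals `[a , a+l)` of ℕ carrying periodic functions, so that no
-- window wraps around. The monoid is a parameter because counts in ℕ and sums in ℤ₂ᵏ are split and
-- slid in the same way.
module WindowSum (M : CommutativeMonoid 0ℓ 0ℓ) where

  open CommutativeMonoid M
  open import Relation.Binary.Reasoning.Setoid setoid
  open CommutativeSemigroupProperties commutativeSemigroup using (interchange)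

  ∑ : (ℕ → Carrier) → ℕ → ℕ → Carrier
  ∑ f a zero    = ε
  ∑ f a (suc l) = f a ∙ ∑ f (suc a) l

  ∑-cong : ∀ {f g} → (∀ i → f i ≈ g i) → ∀ a l → ∑ f a l ≈ ∑ g a l
  ∑-cong f≈g a zero    = CommutativeMonoid.refl M
  ∑-cong f≈g a (suc l) = ∙-cong (f≈g a) (∑-cong f≈g (suc a) l)

  ∑-∙ : ∀ f g a l → ∑ (λ i → f i ∙ g i) a l ≈ ∑ f a l ∙ ∑ g a l
  ∑-∙ f g a zero    = CommutativeMonoid.sym M (identityˡ ε)
  ∑-∙ f g a (suc l) = begin
    f a ∙ g a ∙ ∑ _ (suc a) l                        ≈⟨ ∙-congˡ (∑-∙ f g (suc a) l) ⟩
    f a ∙ g a ∙ (∑ f (suc a) l ∙ ∑ g (suc a) l)      ≈⟨ interchange _ _ _ _ ⟩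
    f a ∙ ∑ f (suc a) l ∙ (g a ∙ ∑ g (suc a) l)      ∎

  ∑-++ : ∀ f a p q → ∑ f a (p ℕ.+ q) ≈ ∑ f a p ∙ ∑ f (a ℕ.+ p) q
  ∑-++ f a zero q rewrite ℕ.+-identityʳ a = CommutativeMonoid.sym M (identityˡ _)
  ∑-++ f a (suc p) q rewrite ℕ.+-suc a p = begin
    f a ∙ ∑ f (suc a) (p ℕ.+ q)                        ≈⟨ ∙-congˡ (∑-++ f (suc a) p q) ⟩
    f a ∙ (∑ f (suc a) p ∙ ∑ f (suc (a ℕ.+ p)) q)      ≈⟨ assoc _ _ _ ⟨
    f a ∙ ∑ f (suc a) p ∙ ∑ f (suc (a ℕ.+ p)) q        ∎

  ∑-slide : ∀ f a l → f a ∙ ∑ f (suc a) l ≈ ∑ f a l ∙ f (a ℕ.+ l)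
  ∑-slide f a l = begin
    ∑ f a (suc l)                       ≡⟨ cong (∑ f a) (ℕ.+-comm 1 l) ⟩
    ∑ f a (l ℕ.+ 1)                     ≈⟨ ∑-++ f a l 1 ⟩
    ∑ f a l ∙ (f (a ℕ.+ l) ∙ ε)         ≈⟨ ∙-congˡ (identityʳ _) ⟩
    ∑ f a l ∙ f (a ℕ.+ l)               ∎

  -- Moving a window of full period by one place trades its first term for the term one period
  -- later, which is equal.
  ∑-periodic : ∀ f l → (∀ i → f (i ℕ.+ suc l) ≈ f i) → ∀ a → ∑ f a (suc l) ≈ ∑ f 0 (suc l)
  ∑-periodic f l per zero    = CommutativeMonoid.refl M
  ∑-periodic f l per (suc a) = begin
    ∑ f (suc a) (suc l)                      ≈⟨ ∑-slide f (suc a) l ⟩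
    ∑ f (suc a) l ∙ f (suc a ℕ.+ l)          ≡⟨ cong (λ b → ∑ f (suc a) l ∙ f b) (ℕ.+-suc a l) ⟨
    ∑ f (suc a) l ∙ f (a ℕ.+ suc l)          ≈⟨ ∙-congˡ (per a) ⟩
    ∑ f (suc a) l ∙ f a                      ≈⟨ comm _ _ ⟩
    ∑ f a (suc l)                            ≈⟨ ∑-periodic f l per a ⟩
    ∑ f 0 (suc l)                            ∎

module ∑ℕ = WindowSum ℕ.+-0-commutativeMonoid
module ∑ℤ₂ {k : ℕ} = WindowSum (AbelianGroup.commutativeMonoid (ℤ₂^-abelianGroup k))

-- Counting selected positions

count : (ℕ → Parity) → ℕ → ℕ → ℕ
count x = ∑ℕ.∑ (λ i → ∣ x i ∣ₚ)

count-complement : ∀ x a l → count x a l ℕ.+ count (ℙ._⁻¹ ∘ x) a l ≡ l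
count-complement x a l = trans (sym (∑ℕ.∑-∙ _ _ a l)) (lemma a l)
  where
  ∣p∣+∣p⁻¹∣≡1 : ∀ p → ∣ p ∣ₚ ℕ.+ ∣ p ℙ.⁻¹ ∣ₚ ≡ 1
  ∣p∣+∣p⁻¹∣≡1 0ℙ = refl
  ∣p∣+∣p⁻¹∣≡1 1ℙ = refl
  lemma : ∀ a l → ∑ℕ.∑ (λ i → ∣ x i ∣ₚ ℕ.+ ∣ x i ℙ.⁻¹ ∣ₚ) a l ≡ l
  lemma a zero    = refl
  lemma a (suc l) = cong₂ ℕ._+_ (∣p∣+∣p⁻¹∣≡1 (x a)) (lemma (suc a) l)

∣∣ₚ-injective : ∀ {p q} → ∣ p ∣ₚ ≡ ∣ q ∣ₚ → p ≡ q
∣∣ₚ-injective {0ℙ} {0ℙ} _ = refl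
∣∣ₚ-injective {1ℙ} {1ℙ} _ = refl

-- In both pairs the first entry is half of the common total, rounded down.
halves-unique : ∀ {a b a′ b′} → a ≤ b → b ≤ suc a → a′ ≤ b′ → b′ ≤ suc a′ →
                a ℕ.+ b ≡ a′ ℕ.+ b′ → a ≡ a′
halves-unique a≤b b≤1+a a′≤b′ b′≤1+a′ eq =
  ℕ.≤-antisym (lemma b′≤1+a′ a≤b eq) (lemma b≤1+a a′≤b′ (sym eq))
  where
  lemma : ∀ {a b a′ b′} → b′ ≤ suc a′ → a ≤ b → a ℕ.+ b ≡ a′ ℕ.+ b′ → a ≤ a′
  lemma b′≤1+a′ a≤b eq = ℕ.≮⇒≥ λ a′<a → ℕ.<⇒≢
    (ℕ.+-mono-<-≤ a′<a (ℕ.≤-trans b′≤1+a′ (ℕ.≤-trans a′<a a≤b))) (sym eq)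

balanced⇒constant :
  ∀ n (x : ℕ → Parity) → (∀ i → x (i ℕ.+ suc (n ℕ.+ n)) ≡ x i) →
  (∀ a → count x a n ≤ count x (a ℕ.+ n) (suc n)) →
  (∀ a → count x (a ℕ.+ n) (suc n) ≤ suc (count x a n)) →
  ∀ a → x a ≡ x 0
balanced⇒constant n x per lower upper = constant
  where
  open ≡-Reasoning
  total : ∀ a → count x a n ℕ.+ count x (a ℕ.+ n) (suc n) ≡ count x 0 (suc (n ℕ.+ n))
  total a = begin
    count x a n ℕ.+ count x (a ℕ.+ n) (suc n)   ≡⟨ ∑ℕ.∑-++ _ a n (suc n) ⟨
    count x a (n ℕ.+ suc n)                     ≡⟨ cong (count x a) (ℕ.+-suc n n) ⟩
    count x a (suc (n ℕ.+ n))                   ≡⟨ ∑ℕ.∑-periodic _ (n ℕ.+ n) (cong ∣_∣ₚ ∘ per) a ⟩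
    count x 0 (suc (n ℕ.+ n))                   ∎
  half-constant : ∀ a → count x (suc a) n ≡ count x a n
  half-constant a = halves-unique (lower (suc a)) (upper (suc a)) (lower a) (upper a)
    (trans (total (suc a)) (sym (total a)))
  -- Sliding the window drops position a and gains position a + n; since the count is unchanged, the
  -- two entries agree.
  n-periodic : ∀ a → x a ≡ x (a ℕ.+ n)
  n-periodic a = ∣∣ₚ-injective (ℕ.+-cancelˡ-≡ (count x a n) _ _ (begin
    count x a n ℕ.+ ∣ x a ∣ₚ            ≡⟨ ℕ.+-comm (count x a n) _ ⟩
    ∣ x a ∣ₚ ℕ.+ count x a n            ≡⟨ cong (∣ x a ∣ₚ ℕ.+_) (half-constant a) ⟨
    ∣ x a ∣ₚ ℕ.+ count x (suc a) n      ≡⟨ ∑ℕ.∑-slide _ a n ⟩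
    count x a n ℕ.+ ∣ x (a ℕ.+ n) ∣ₚ    ∎))
  constant : ∀ a → x a ≡ x 0
  constant zero    = refl
  constant (suc a) = begin
    -- Two shifts by n lead from a + 1 to a + 2n + 1, one full turn past a.
    x (suc a)                    ≡⟨ n-periodic (suc a) ⟩
    x (suc a ℕ.+ n)              ≡⟨ n-periodic (suc a ℕ.+ n) ⟩
    x (suc a ℕ.+ n ℕ.+ n)        ≡⟨ cong x (cong suc (ℕ.+-assoc a n n)) ⟩
    x (suc (a ℕ.+ (n ℕ.+ n)))    ≡⟨ cong x (ℕ.+-suc a (n ℕ.+ n)) ⟨
    x (a ℕ.+ suc (n ℕ.+ n))      ≡⟨ per a ⟩
    x a                          ≡⟨ constant a ⟩
    x 0                          ∎

-- Linear dependence

toFin : Parity → Fin 2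
toFin 0ℙ = Fin.zero
toFin 1ℙ = Fin.suc Fin.zero

fromFin : Fin 2 → Parity
fromFin Fin.zero    = 0ℙ
fromFin (Fin.suc _) = 1ℙ

fromFin-toFin : ∀ p → fromFin (toFin p) ≡ p
fromFin-toFin 0ℙ = refl
fromFin-toFin 1ℙ = refl

toFin-fromFin : ∀ b → toFin (fromFin b) ≡ b
toFin-fromFin Fin.zero           = refl
toFin-fromFin (Fin.suc Fin.zero) = refl

-- Vectors are read as binary numerals, which makes the pigeonhole principle on `Fin` applicable.
encode : ∀ {k} → ℤ₂^ k → Fin (2 ℕ.^ k)
encode []      = Fin.zero
encode (p ∷ g) = combine (toFin p) (encode g)

encode-injective : ∀ {k} (g h : ℤ₂^ k) → encode g ≡ encode h → g ≡ h
encode-injective []      []      _  = refl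
encode-injective (p ∷ g) (q ∷ h) eq
  with p≡q , g≡h ← combine-injective (toFin p) (encode g) (toFin q) (encode h) eq =
  cong₂ _∷_ (trans (sym (fromFin-toFin p)) (trans (cong fromFin p≡q) (fromFin-toFin q)))
            (encode-injective g h g≡h)

decode : ∀ k → Fin (2 ℕ.^ k) → ℤ₂^ k
decode zero    _ = []
decode (suc k) t = let b , r = remQuot {2} (2 ℕ.^ k) t in fromFin b ∷ decode k r

encode-decode : ∀ k t → encode (decode k t) ≡ t
encode-decode zero    Fin.zero = refl
encode-decode (suc k) t        =
  let b , r = remQuot {2} (2 ℕ.^ k) t in
  trans (cong₂ combine (toFin-fromFin b) (encode-decode k r)) (combine-remQuot {2} (2 ℕ.^ k) t)

-- Counting replaces a rank argument: among the 2ᵏ vectors two distinct ones have the same image,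
-- and their sum, which is also their difference, is a nonzero element of the kernel.
nontrivialKernel : ∀ {j k} → j < k → (φ : ℤ₂^ k → ℤ₂^ j) →
                   (∀ g h → φ (g + h) ≡ φ g + φ h) → ∃[ g ] g ≢ 0# × φ g ≡ 0#
nontrivialKernel {j} {k} j<k φ φ-+
  with t , t′ , t<t′ , eq ←
    pigeonhole (ℕ.^-monoʳ-< 2 (s≤s (s≤s z≤n)) j<k) (encode ∘ φ ∘ decode k)
  = g + g′
  , (λ g+g′≡0 → <⇒≢ t<t′ (trans (sym (encode-decode k t))
      (trans (cong encode (ℤ₂^.inverseˡ-unique g g′ g+g′≡0)) (encode-decode k t′))))
  , trans (φ-+ g g′)
      (trans (cong (_+ φ g′) (encode-injective (φ g) (φ g′) eq)) (+-same (φ g′)))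
  where
  g  = decode k t
  g′ = decode k t′

-- Lower bound

infixr 7 _·_

_·_ : ∀ {k} → Parity → ℤ₂^ k → ℤ₂^ k
0ℙ · g = 0#
1ℙ · g = g

·-distribʳ-+ : ∀ {k} (g : ℤ₂^ k) p q → (p ℙ.+ q) · g ≡ p · g + q · g
·-distribʳ-+ g 0ℙ q  = sym (ℤ₂^.identityˡ _)
·-distribʳ-+ g 1ℙ 0ℙ = sym (ℤ₂^.identityʳ g)
·-distribʳ-+ g 1ℙ 1ℙ = sym (+-same g)

-- `F` is the embedded cycle unrolled along ℕ into an infinite walk.
module Steps {j : ℕ} (S : Pred (ℤ₂^ j) 0ℓ) (0∉S : ¬ S 0#) (F : ℕ → ℤ₂^ j)
             (F-adj : ∀ i → Graph.Adj (Cay j S 0∉S) (F i) (F (suc i))) where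

  H : Graph
  H = Cay j S 0∉S

  -- In characteristic 2 the sum of the two end points of an edge is the generator that it uses.
  step : ℕ → ℤ₂^ j
  step i = F i + F (suc i)

  step∈S : ∀ i → S (step i)
  step∈S i with s , s∈S , eq ← F-adj i =
    subst S (sym (trans (cong (F i +_) eq) (ℤ₂^.g+[g+h]≡h (F i) s))) s∈S

  select : (ℕ → Parity) → ℕ → ℕ → ℤ₂^ j
  select x = ∑ℤ₂.∑ (λ i → x i · step i)

  select-+ : ∀ x y a l → select (λ i → x i ℙ.+ y i) a l ≡ select x a l + select y a l
  select-+ x y a l =
    trans (∑ℤ₂.∑-cong (λ i → ·-distribʳ-+ (step i) (x i) (y i)) a l) (∑ℤ₂.∑-∙ _ _ a l)

  telescope : ∀ a l → ∑ℤ₂.∑ step a l ≡ F a + F (a ℕ.+ l)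
  telescope a zero rewrite ℕ.+-identityʳ a = sym (+-same (F a))
  telescope a (suc l) rewrite ℕ.+-suc a l = begin
    step a + ∑ℤ₂.∑ step (suc a) l                       ≡⟨ cong (step a +_) (telescope (suc a) l) ⟩
    F a + F (suc a) + (F (suc a) + F (suc (a ℕ.+ l)))   ≡⟨ ℤ₂^.assoc (F a) _ _ ⟩
    F a + (F (suc a) + (F (suc a) + F (suc (a ℕ.+ l)))) ≡⟨ cong (F a +_) (ℤ₂^.g+[g+h]≡h (F (suc a)) _) ⟩
    F a + F (suc (a ℕ.+ l))                             ∎
    where open ≡-Reasoning

  -- The whole window telescopes to its end points, and the selected steps are taken away from it by
  -- adding them. The proof relies on `1ℙ ℙ.+ p` computing to `p ℙ.⁻¹`.
  select-complement : ∀ x a l → select (ℙ._⁻¹ ∘ x) a l ≡ F a + F (a ℕ.+ l) + select x a l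
  select-complement x a l = trans (select-+ (λ _ → 1ℙ) x a l) (cong (_+ select x a l) (telescope a l))

  -- A generator can be applied at any vertex, so even a scattered selection of steps spells a walk,
  -- whose length is the number of selected positions.
  select-walk : ∀ x a l g → Walk H g (g + select x a l) (count x a l)
  select-walk x a zero    g = subst (λ h → Walk H g h 0) (sym (ℤ₂^.identityʳ g)) nil
  select-walk x a (suc l) g with x a
  ... | 0ℙ = subst (λ h → Walk H g h _) (cong (g +_) (sym (ℤ₂^.identityˡ _)))
               (select-walk x (suc a) l g)
  ... | 1ℙ = cons (step a , step∈S a , refl)
               (subst (λ h → Walk H (g + step a) h _) (ℤ₂^.assoc g (step a) _)
                 (select-walk x (suc a) l (g + step a)))

  -- Replacing W = [a , a+n) by W △ x, which spells the same element, gives a walk from F a to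
  -- F (a+n) using the n − |W ∩ x| steps of W outside x and the steps of x outside W.
  count-half-≤ :
    ∀ n → (∀ a l → Walk H (F a) (F (a ℕ.+ n)) l → n ≤ l) →
    ∀ x → (∀ a → select x a (suc (n ℕ.+ n)) ≡ 0#) →
    ∀ a → count x a n ≤ count x (a ℕ.+ n) (suc n)
  count-half-≤ n geodesic x x∈ker a = ℕ.+-cancelˡ-≤ (count x̄ a n) _ _ (let open ≤-Reasoning in begin
    count x̄ a n ℕ.+ count x a n                    ≡⟨ ℕ.+-comm (count x̄ a n) _ ⟩
    count x a n ℕ.+ count x̄ a n                    ≡⟨ count-complement x a n ⟩
    n                                              ≤⟨ geodesic a _ walk ⟩
    count x̄ a n ℕ.+ count x (a ℕ.+ n) (suc n)      ∎)
    where
    x̄ = ℙ._⁻¹ ∘ x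
    P = select x a n
    Q = select x (a ℕ.+ n) (suc n)
    -- The selection sums to 0 over a full turn, so its parts inside and outside W have the same
    -- sum.
    P≡Q : P ≡ Q
    P≡Q = ℤ₂^.inverseˡ-unique P Q (trans (sym (∑ℤ₂.∑-++ _ a n (suc n)))
      (trans (cong (select x a) (ℕ.+-suc n n)) (x∈ker a)))
    end : F a + select x̄ a n + Q ≡ F (a ℕ.+ n)
    end = begin
      F a + select x̄ a n + Q               ≡⟨ cong (λ h → F a + h + Q) (select-complement x a n) ⟩
      F a + (F a + F (a ℕ.+ n) + P) + Q    ≡⟨ cong (_+ Q) (ℤ₂^.assoc (F a) _ P) ⟨
      F a + (F a + F (a ℕ.+ n)) + P + Q    ≡⟨ cong (λ h → h + P + Q) (ℤ₂^.g+[g+h]≡h (F a) _) ⟩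
      F (a ℕ.+ n) + P + Q                  ≡⟨ ℤ₂^.assoc _ P Q ⟩
      F (a ℕ.+ n) + (P + Q)                ≡⟨ cong (λ h → F (a ℕ.+ n) + (h + Q)) P≡Q ⟩
      F (a ℕ.+ n) + (Q + Q)                ≡⟨ cong (F (a ℕ.+ n) +_) (+-same Q) ⟩
      F (a ℕ.+ n) + 0#                     ≡⟨ ℤ₂^.identityʳ _ ⟩
      F (a ℕ.+ n)                          ∎
      where open ≡-Reasoning
    walk : Walk H (F a) (F (a ℕ.+ n)) (count x̄ a n ℕ.+ count x (a ℕ.+ n) (suc n))
    walk = subst (λ h → Walk H (F a) h (count x̄ a n ℕ.+ count x (a ℕ.+ n) (suc n))) end
      (Walk-++ (select-walk x̄ a n (F a)) (select-walk x (a ℕ.+ n) (suc n) _))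

  -- The two bounds required by `balanced⇒constant` are `count-half-≤` for x and for its complement.
  kernel-constant :
    ∀ n → (∀ a l → Walk H (F a) (F (a ℕ.+ n)) l → n ≤ l) →
    (∀ i → F (i ℕ.+ suc (n ℕ.+ n)) ≡ F i) →
    ∀ x → (∀ i → x (i ℕ.+ suc (n ℕ.+ n)) ≡ x i) →
    select x 0 (suc (n ℕ.+ n)) ≡ 0# →
    ∀ a → x a ≡ x 0
  kernel-constant n geodesic F-per x x-per x∈ker =
    balanced⇒constant n x x-per (count-half-≤ n geodesic x x∈ker′) upper
    where
    m = suc (n ℕ.+ n)
    x̄ = ℙ._⁻¹ ∘ x
    x∈ker′ : ∀ a → select x a m ≡ 0#
    x∈ker′ a = trans (∑ℤ₂.∑-periodic _ (n ℕ.+ n) per a) x∈ker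
      where
      per : ∀ i → x (i ℕ.+ m) · step (i ℕ.+ m) ≡ x i · step i
      per i = cong₂ _·_ (x-per i) (cong₂ _+_ (F-per i) (F-per (suc i)))
    -- All steps of one full turn sum to 0 because the walk closes up, so the complement of a kernel
    -- element is again in the kernel.
    x̄∈ker : ∀ a → select x̄ a m ≡ 0#
    x̄∈ker a = begin
      select x̄ a m                         ≡⟨ select-complement x a m ⟩
      F a + F (a ℕ.+ m) + select x a m     ≡⟨ cong₂ (λ g h → F a + g + h) (F-per a) (x∈ker′ a) ⟩
      F a + F a + 0#                       ≡⟨ ℤ₂^.identityʳ _ ⟩
      F a + F a                            ≡⟨ +-same (F a) ⟩
      0#                                   ∎
      where open ≡-Reasoning
    -- The summand 1 arises because the complementary window has n + 1 positions while W has n.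
    upper : ∀ a → count x (a ℕ.+ n) (suc n) ≤ suc (count x a n)
    upper a = ℕ.+-cancelʳ-≤ (count x̄ (a ℕ.+ n) (suc n)) _ _ (begin
      count x (a ℕ.+ n) (suc n) ℕ.+ count x̄ (a ℕ.+ n) (suc n)   ≡⟨ count-complement x (a ℕ.+ n) (suc n) ⟩
      suc n                                                     ≡⟨ cong suc (count-complement x a n) ⟨
      suc (count x a n ℕ.+ count x̄ a n)
        ≤⟨ s≤s (ℕ.+-monoʳ-≤ (count x a n) (count-half-≤ n geodesic x̄ x̄∈ker a)) ⟩
      suc (count x a n) ℕ.+ count x̄ (a ℕ.+ n) (suc n)           ∎)
      where open ≤-Reasoning

-- The representatives of the two ends differ by n, or by n + 1 if the arc passes 0. As m = 2n + 1,
-- either alternative of `cycle-walk-bound` then yields a length of at least n.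
cycle-half-geodesic :
  ∀ n (3≤m : 3 ≤ suc (n ℕ.+ n)) a l →
  Walk (cycle (suc (n ℕ.+ n)) 3≤m) (a mod suc (n ℕ.+ n)) ((a ℕ.+ n) mod suc (n ℕ.+ n)) l →
  n ≤ l
cycle-half-geodesic zero       3≤m a l π = z≤n
-- Matching on n exposes m as a double successor, the form in which `Upper` takes the length of the
-- cycle.
cycle-half-geodesic n@(suc n′) 3≤m a l π = cases bound
  where
  m = suc (n ℕ.+ n)
  b = a % m
  c = (b ℕ.+ n) % m
  bound : ∣ b - c ∣ ≤ l ⊎ m ≤ ∣ b - c ∣ ℕ.+ l
  bound = subst₂ (λ u v → ∣ u - v ∣ ≤ l ⊎ m ≤ ∣ u - v ∣ ℕ.+ l)
    (toℕ-mod a (n ℕ.+ n))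
    (trans (toℕ-mod (a ℕ.+ n) (n ℕ.+ n)) (sym (%-+ˡ a n (n ℕ.+ n))))
    (Upper.cycle-walk-bound (n′ ℕ.+ n) 3≤m π)
  distance : ∣ b - c ∣ ≡ n ⊎ ∣ b - c ∣ ≡ suc n
  distance with b ℕ.+ n ℕ.<? m
  ... | yes b+n<m = inj₁ (trans (cong ∣ b -_∣ (m<n⇒m%n≡m b+n<m)) (ℕ.∣m-m+n∣≡n b n))
  -- After wrapping, the end is e = b + n - m, so b = e + (n + 1).
  ... | no  b+n≮m = inj₂ (trans (cong₂ ∣_-_∣ (sym e+1+n≡b) c≡e)
    (trans (ℕ.∣-∣-comm (e ℕ.+ suc n) e) (ℕ.∣m-m+n∣≡n e (suc n))))
    where
    open ≡-Reasoning
    e = b ℕ.+ n ∸ m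
    e+m≡b+n : e ℕ.+ m ≡ b ℕ.+ n
    e+m≡b+n = ℕ.m∸n+n≡m (ℕ.≮⇒≥ b+n≮m)
    e+1+n≡b : e ℕ.+ suc n ≡ b
    e+1+n≡b = ℕ.+-cancelʳ-≡ n _ _ (trans (ℕ.+-assoc e (suc n) n) e+m≡b+n)
    e<m : e < m
    e<m = ℕ.≤-<-trans (subst (e ≤_) e+1+n≡b (ℕ.m≤m+n e (suc n))) (m%n<n a m)
    c≡e : c ≡ e
    c≡e = begin
      (b ℕ.+ n) % m    ≡⟨ cong (_% m) e+m≡b+n ⟨
      (e ℕ.+ m) % m    ≡⟨ [m+n]%n≡m%n e m ⟩
      e % m            ≡⟨ m<n⇒m%n≡m e<m ⟩
      e                ∎
  cases : ∣ b - c ∣ ≤ l ⊎ m ≤ ∣ b - c ∣ ℕ.+ l → n ≤ l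
  cases bd with distance
  cases (inj₁ d≤l)   | inj₁ d≡n   = subst (_≤ l) d≡n d≤l
  cases (inj₁ d≤l)   | inj₂ d≡1+n = ℕ.≤-trans (ℕ.n≤1+n n) (subst (_≤ l) d≡1+n d≤l)
  cases (inj₂ m≤d+l) | inj₁ d≡n   = ℕ.≤-trans (ℕ.n≤1+n n)
    (ℕ.+-cancelˡ-≤ n _ _ (subst₂ _≤_ (sym (ℕ.+-suc n n)) (cong (ℕ._+ l) d≡n) m≤d+l))
  cases (inj₂ m≤d+l) | inj₂ d≡1+n =
    ℕ.+-cancelˡ-≤ (suc n) _ _ (subst (m ≤_) (cong (ℕ._+ l) d≡1+n) m≤d+l)

-- A vector of length 2n is a set of positions among 1, ..., 2n. If j < 2n, some nonzero vector
-- selects steps with sum 0; by `kernel-constant` its selection is constant, hence equal to its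
-- value `0ℙ` at position 0, which is a contradiction.
dimension-bound : ∀ n (3≤m : 3 ≤ suc (n ℕ.+ n)) j →
                  EmbedsInDimension (cycle (suc (n ℕ.+ n)) 3≤m) j → n ℕ.+ n ≤ j
dimension-bound n 3≤m j (S , 0∉S , _ , f , iso) = ℕ.≮⇒≥ λ j<n+n →
  let g , g≢0 , φg≡0 = nontrivialKernel j<n+n φ φ-+
      constant = kernel-constant n geodesic F-periodic (χ g) (χ-periodic g) φg≡0
  in g≢0 (∷-injectiveʳ (Pointwise-≡⇒≡ (ext λ i → trans
       (cong (lookup (0ℙ ∷ g)) (sym (mod-toℕ i)))
       (trans (constant (toℕ i)) (sym (lookup-replicate i 0ℙ))))))
  where
  open Cycle (n ℕ.+ n) 3≤m
  F : ℕ → ℤ₂^ j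
  F i = f (i mod m)
  F-periodic : ∀ i → F (i ℕ.+ m) ≡ F i
  F-periodic i = cong f (mod-periodic (n ℕ.+ n) i)
  open Steps S 0∉S F (λ i → isometric⇒Adj {C} {Cay j S 0∉S} iso (cycle-step i))
  geodesic : ∀ a l → Walk H (F a) (F (a ℕ.+ n)) l → n ≤ l
  geodesic a = proj₂ (Equivalence.to (iso _ _ n)
    (arc-walk a n , cycle-half-geodesic n 3≤m a))
  -- Position 0 is never selected, so that the only constant selection is the empty one.
  χ : ℤ₂^ (n ℕ.+ n) → ℕ → Parity
  χ g i = lookup (0ℙ ∷ g) (i mod m)
  χ-periodic : ∀ g i → χ g (i ℕ.+ m) ≡ χ g i
  χ-periodic g i = cong (lookup (0ℙ ∷ g)) (mod-periodic (n ℕ.+ n) i)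
  φ : ℤ₂^ (n ℕ.+ n) → ℤ₂^ j
  φ g = select (χ g) 0 m
  φ-+ : ∀ g h → φ (g + h) ≡ φ g + φ h
  φ-+ g h = trans
    (∑ℤ₂.∑-cong (λ i → cong (_· step i) (lookup-zipWith ℙ._+_ (i mod m) (0ℙ ∷ g) (0ℙ ∷ h))) 0 m)
    (select-+ (χ g) (χ h) 0 m)

theorem2p40 : ∀ (m : ℕ) (3≤m : 3 ≤ m) → m % 2 ≡ 1 →
    m ≤ 17 ⊎ CyclicIntervalProperty m {{ 3≤⇒nonZero 3≤m }} →
    IsKMin (cycle m 3≤m) (m ∸ 1)
theorem2p40 (suc zero) (s≤s ())
theorem2p40 m@(suc (suc k)) 3≤m m-odd _ =
  Upper.embeds k 3≤m , lower (m / 2) m≡1+n+n 3≤m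
  where
  m≡1+n+n : m ≡ suc (m / 2 ℕ.+ m / 2)
  m≡1+n+n = trans (m≡m%n+[m/n]*n m 2) (cong₂ ℕ._+_ m-odd
    (trans (ℕ.*-comm (m / 2) 2) (cong (m / 2 ℕ.+_) (ℕ.+-identityʳ (m / 2)))))
  -- Here m is a variable, so that matching on `refl` can rewrite it to 2n + 1 inside the type of
  -- the cycle as well.
  lower : ∀ {m} n → m ≡ suc (n ℕ.+ n) → (3≤m : 3 ≤ m) →
          ∀ j → EmbedsInDimension (cycle m 3≤m) j → m ∸ 1 ≤ j
  lower n refl = dimension-bound n
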